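{- For every $d\in\{5,6,7\}$ and every even integer $\ell>2$, except when $\ell=4$ and $d\in\{6,7\}$, there is a cracked graceful permutation of length $2\ell-1$ with crack $\ell-2$ whose first element is $\ell+1$, whose last element is $\ell$, and whose first absolute difference is $d$.
   Context: A cracked graceful permutation of length $n$ is an arrangement $(a_1,\dots,a_n)$ of $n$ distinct integers from $\{0,1,\dots,n\}$ such that its absolute differences $|a_{i+1}-a_i|$ ($1\le i\le n-1$) are exactly the integers $\{1,\dots,n-1\}$; the missing element of $\{0,\dots,n\}$ is the crack. The first absolute difference is $|a_2-a_1|$. -}

module Defs where

open import Data.List.Base using (List; length; drop; zipWith)
open import Data.List.Membership.Propositional using (_∈_; _∉_)
open import Data.List.Relation.Unary.All using (All)
open import Data.List.Relation.Unary.Unique.Propositional using (Unique)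
open import Data.Nat.Base using (ℕ; _≤_; _<_; ∣_-_∣)
open import Data.Product.Base using (_×_)
open import Function.Bundles using (_⇔_)
open import Relation.Binary.PropositionalEquality.Core using (_≡_)

-- For (a₁, …, aₙ) this is (∣a₂ - a₁∣, …, ∣aₙ - aₙ₋₁∣): zipWith stops at the
-- end of the shorter list.
differences : List ℕ → List ℕ
differences as = zipWith ∣_-_∣ (drop 1 as) as

record CrackedGraceful (n : ℕ) (as : List ℕ) : Set where
  field
    length≡n          : length as ≡ n
    bounded           : All (_≤ n) as
    distinct          : Unique as
    differences-exact : ∀ k → k ∈ differences as ⇔ (1 ≤ k × k < n)

IsCrack : (n : ℕ) → List ℕ → ℕ → Set
IsCrack n as c = c ≤ n × c ∉ as

{-# OPTIONS --safe #-}
module Submission where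

open import Defs
open import Data.Empty using (⊥-elim)
open import Data.List.Base using (List; head; last; []; _∷_; _++_; concatMap; length; map; upTo; zipWith)
open import Data.List.Membership.Propositional using (_∈_)
open import Data.List.Membership.Propositional.Properties using (∈-∃++; ∈-++⁺ˡ; ∈-++⁺ʳ; ∈-upTo⁻)
open import Data.List.Properties using (++-assoc; length-++; length-upTo; length-zipWith)
open import Data.List.Relation.Binary.Permutation.Propositional using (_↭_; prep; refl; ↭-sym; ↭-trans; ↭⇒↭ₛ)
open import Data.List.Relation.Binary.Permutation.Propositional.Properties using (∈-resp-↭; shift; ↭-length)
import Data.List.Relation.Binary.Permutation.Setoid.Properties as Permutationₛ
open import Data.List.Relation.Unary.All as All using (All; []; _∷_)
import Data.List.Relation.Unary.All.Properties as All
open import Data.List.Relation.Unary.AllPairs using (_∷_)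
open import Data.List.Relation.Unary.Any using (here; there)
open import Data.List.Relation.Unary.Unique.Propositional using (Unique)
open import Data.List.Relation.Unary.Unique.Propositional.Properties using (upTo⁺)
open import Data.Maybe.Base using (Maybe; just; nothing; _>>=_; from-just)
open import Data.Nat.Base using (ℕ; zero; suc; _+_; _*_; _∸_; _<_; _≤_; s≤s; s≤s⁻¹; ∣_-_∣)
open import Data.Nat.Divisibility using (_∣_; divides)
open import Data.Nat.Properties
open import Data.Nat.Tactic.RingSolver using (solve-∀)
open import Data.Product.Base using (_×_; _,_; ∃; ∃-syntax; proj₁; proj₂)
open import Data.Product.Properties using (≡-dec)
open import Data.Sum.Base using (inj₁; inj₂)
open import Function.Base using (_∘_; case_of_)
open import Function.Bundles using (mk⇔)
open import Relation.Binary.Definitions using (DecidableEquality)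
open import Relation.Binary.PropositionalEquality.Core using (_≡_; refl; sym; trans; cong; cong₂; subst)
open import Relation.Binary.PropositionalEquality.Properties using (setoid)
open import Relation.Nullary.Decidable.Core using (yes; no; dec⇒maybe)
open import Relation.Nullary.Negation.Core using (¬_)

-- Start from the zigzag that always uses the largest unused difference: 0, 2ℓ - 2, 1, 2ℓ - 3, …. Both
-- ends of the wanted permutation lie in the centre, so the path must jump between the centre and the
-- extremes; one extreme value is moreover visited on an excursion from the centre.  This spends three
-- differences close to ℓ in advance.  When the zigzag arrives at such a spent difference it either takes
-- a step 1 on one side or leaves out a vertex.  Two vertices are left out, near ℓ / 2 or 3ℓ / 2, and
-- visited on excursions from the centre as well; these spend four differences close to ℓ / 2, around
-- which the zigzag is locally rearranged using four small differences.  What is left is a problem of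
-- bounded size in the centre.  The positions depend on ℓ modulo 4, so for each d this gives two
-- families; the few smaller ℓ are treated one by one.
--
-- All values, all differences and the lengths of all zigzags are affine in a parameter k with ℓ = r + 4k.
-- It therefore suffices to check, on coefficients, that finitely many intervals tile {0, …, 2ℓ - 1} and
-- {0, …, 2ℓ - 2}.

-- Lists that exhaust an initial segment

∈-≡ : ∀ {v w} {xs : List ℕ} → v ≡ w → v ∈ xs → w ∈ xs
∈-≡ refl v∈ = v∈

-- Pigeonhole: after one occurrence of `y` is deleted from `xs`, the later entries of `ys` are still
-- present, since uniqueness makes them differ from `y`.
Unique-exhausts : ∀ {ys xs : List ℕ} → Unique ys → (∀ {v} → v ∈ ys → v ∈ xs) →
                  length xs ≡ length ys → xs ↭ ys
Unique-exhausts {[]} {[]} _ _ _ = refl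
Unique-exhausts {y ∷ ys} (y∉ys ∷ uys) ys⊆xs eq
  with us , vs , refl ← ∈-∃++ (ys⊆xs (here refl)) =
  ↭-trans (shift y us vs) (prep y (Unique-exhausts uys ys⊆rest
    (suc-injective (trans (sym (↭-length (shift y us vs))) eq))))
  where
  ys⊆rest : ∀ {v} → v ∈ ys → v ∈ us ++ vs
  ys⊆rest v∈ys with ∈-resp-↭ (shift y us vs) (ys⊆xs (there v∈ys))
  ... | here refl = ⊥-elim (All.lookup y∉ys v∈ys refl)
  ... | there v∈rest = v∈rest

exhausts-upTo : ∀ {m xs} → (∀ v → v < m → v ∈ xs) → length xs ≡ m → xs ↭ upTo m
exhausts-upTo {m} covers eq =
  Unique-exhausts (upTo⁺ m) (λ v∈ → covers _ (∈-upTo⁻ v∈)) (trans eq (sym (length-upTo m)))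

Unique-↭-upTo : ∀ {m xs} → xs ↭ upTo m → Unique xs
Unique-↭-upTo {m} xs↭ = Permutationₛ.Unique-resp-↭ (setoid ℕ) (↭⇒↭ₛ (↭-sym xs↭)) (upTo⁺ m)

-- The preceding vertex is a separate argument so that a path can be cut into pieces; `steps a as`
-- computes to `differences (a ∷ as)`.
steps : ℕ → List ℕ → List ℕ
steps p xs = zipWith ∣_-_∣ xs (p ∷ xs)

length-steps : ∀ p xs → length (steps p xs) ≡ length xs
length-steps p xs = trans (length-zipWith ∣_-_∣ xs (p ∷ xs)) (m≤n⇒m⊓n≡m (n≤1+n (length xs)))

-- Prepending the crack to the vertices and 0 to the differences turns both conditions into
-- "these m numbers exhaust {0, …, m - 1}".
cracked-graceful : ∀ {n c a as} → length (a ∷ as) ≡ n →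
                   (∀ v → v < suc n → v ∈ c ∷ a ∷ as) → (∀ v → v < n → v ∈ 0 ∷ steps a as) →
                   CrackedGraceful n (a ∷ as) × IsCrack n (a ∷ as) c
cracked-graceful {n} {c} {a} {as} length≡ vertices edges
  with vs ← exhausts-upTo vertices (cong suc length≡)
  with es ← exhausts-upTo edges (trans (cong suc (length-steps a as)) length≡)
  with c∉as ∷ uas ← Unique-↭-upTo vs
  with 0∉es ∷ _ ← Unique-↭-upTo es
  = record
      { length≡n = length≡
      ; bounded = All.tabulate (λ v∈ → s≤s⁻¹ (∈-upTo⁻ (∈-resp-↭ vs (there v∈))))
      ; distinct = uas
      ; differences-exact = λ k → mk⇔
          (λ k∈ → n≢0⇒n>0 (All.lookup 0∉es k∈ ∘ sym) , ∈-upTo⁻ (∈-resp-↭ es (there k∈)))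
          (λ { (1≤k , k<n) → case edges k k<n of λ
             { (here refl) → ⊥-elim (<-irrefl refl 1≤k) ; (there k∈) → k∈ } })
      }
  , s≤s⁻¹ (∈-upTo⁻ (∈-resp-↭ vs (here refl)))
  , λ c∈ → All.lookup c∉as c∈ refl

Solution : ℕ → ℕ → Set
Solution d ℓ = ∃[ as ] (CrackedGraceful (2 * ℓ ∸ 1) as
                      × IsCrack (2 * ℓ ∸ 1) as (ℓ ∸ 2)
                      × head as ≡ just (ℓ + 1)
                      × last as ≡ just ℓ
                      × head (differences as) ≡ just d)

-- Affine functions of a parameter k, and intervals with affine ends

Affine : Set
Affine = ℕ × ℕ

_≟ₐ_ : DecidableEquality Affine
_≟ₐ_ = ≡-dec _≟_ _≟_

⟦_⟧ : Affine → ℕ → ℕ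
⟦ a , b ⟧ k = a + b * k

infixl 6 _⊕_
_⊕_ : Affine → Affine → Affine
(a , b) ⊕ (c , e) = a + c , b + e

⟦⊕⟧ : ∀ u v k → ⟦ u ⊕ v ⟧ k ≡ ⟦ u ⟧ k + ⟦ v ⟧ k
⟦⊕⟧ (a , b) (c , e) k = lemma a b c e k
  where
  lemma : ∀ a b c e k → a + c + (b + e) * k ≡ a + b * k + (c + e * k)
  lemma = solve-∀

-- Coefficients are only partially ordered. For an incomparable pair the sign of the difference
-- changes with `k`, so no affine distance exists and `distance` fails too.
difference : (u v : Affine) → Maybe (∃ λ e → v ≡ u ⊕ e)
difference (a , b) (c , e) with a ≤? c | b ≤? e
... | yes a≤c | yes b≤e =
  just ((c ∸ a , e ∸ b) , cong₂ _,_ (sym (m+[n∸m]≡n a≤c)) (sym (m+[n∸m]≡n b≤e)))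
... | _ | _ = nothing

distance-⊕ : ∀ u e k → ∣ ⟦ u ⟧ k - ⟦ u ⊕ e ⟧ k ∣ ≡ ⟦ e ⟧ k
distance-⊕ u e k rewrite ⟦⊕⟧ u e k = ∣m-m+n∣≡n (⟦ u ⟧ k) (⟦ e ⟧ k)

distance : (u v : Affine) → Maybe (∃ λ e → ∀ k → ∣ ⟦ u ⟧ k - ⟦ v ⟧ k ∣ ≡ ⟦ e ⟧ k)
distance u v with difference u v | difference v u
... | just (e , refl) | _ = just (e , distance-⊕ u e)
... | nothing | just (e , refl) =
  just (e , λ k → trans (∣-∣-comm (⟦ v ⊕ e ⟧ k) (⟦ v ⟧ k)) (distance-⊕ v e k))
... | nothing | nothing = nothing

-- (s , w) is the interval [s, s + w).
Interval : Set
Interval = Affine × Affine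

Covers : ℕ → List ℕ → Interval → Set
Covers k xs (s , w) = ∀ i → i < ⟦ w ⟧ k → ⟦ s ⟧ k + i ∈ xs

unit : Affine → Interval
unit s = s , (1 , 0)

covers-unit : ∀ {k xs} s → ⟦ s ⟧ k ∈ xs → Covers k xs (unit s)
covers-unit {k} s s∈ zero _ = ∈-≡ (sym (+-identityʳ (⟦ s ⟧ k))) s∈
covers-unit s s∈ (suc i) (s≤s ())

-- Only abutment is recorded; that no number occurs twice follows from the list length in
-- `exhausts-upTo`. Starts and widths are symbolic, so one tiling serves every `k`.
data Tiling (is : List Interval) (end : Affine) : Affine → Set where
  done : Tiling is end end
  _∷_ : ∀ {s w} → (s , w) ∈ is → Tiling is end (s ⊕ w) → Tiling is end s

startingAt : (s : Affine) (is : List Interval) → Maybe (∃ λ w → (s , w) ∈ is)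
startingAt s [] = nothing
startingAt s ((s′ , w) ∷ is) with s ≟ₐ s′
... | yes refl = just (w , here refl)
... | no _ = do
  w′ , ∈is ← startingAt s is
  just (w′ , there ∈is)

-- The fuel makes the search structurally recursive. Callers supply the number of intervals, enough
-- for a chain that uses each one once.
tile : ℕ → ∀ is end s → Maybe (Tiling is end s)
tile zero is end s with s ≟ₐ end
... | yes refl = just done
... | no _ = nothing
tile (suc fuel) is end s = do
  w , ∈is ← startingAt s is
  tiling ← tile fuel is end (s ⊕ w)
  just (∈is ∷ tiling)

-- An offset `i` either falls in the first interval or, reduced by its width, becomes an offset from
-- the next start.
tiling-covers : ∀ {k xs is end s} → Tiling is end s → All (Covers k xs) is →
                ∀ i → ⟦ s ⟧ k + i < ⟦ end ⟧ k → ⟦ s ⟧ k + i ∈ xs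
tiling-covers {s = s} done _ i lt = ⊥-elim (<⇒≱ lt (m≤m+n _ i))
tiling-covers {k} {end = end} {s} (_∷_ {w = w} ∈is tiling) covers i lt with i <? ⟦ w ⟧ k
... | yes i<w = All.lookup covers ∈is i i<w
... | no i≮w = ∈-≡ eq
  (tiling-covers tiling covers (i ∸ ⟦ w ⟧ k) (subst (_< ⟦ end ⟧ k) (sym eq) lt))
  where
  eq : ⟦ s ⊕ w ⟧ k + (i ∸ ⟦ w ⟧ k) ≡ ⟦ s ⟧ k + i
  eq rewrite ⟦⊕⟧ s w k | +-assoc (⟦ s ⟧ k) (⟦ w ⟧ k) (i ∸ ⟦ w ⟧ k) =
    cong (⟦ s ⟧ k +_) (m+[n∸m]≡n (≮⇒≥ i≮w))

-- Zigzags

-- x, y + k - 1, x + 1, y + k - 2, …, x + k - 1, y, x + k.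
zigzag : ℕ → ℕ → ℕ → List ℕ
zigzag zero x y = x ∷ []
zigzag (suc k) x y = x ∷ k + y ∷ zigzag k (suc x) y

zigzagSteps : ℕ → ℕ → ℕ → List ℕ
zigzagSteps zero x y = []
zigzagSteps (suc k) x y = ∣ k + y - x ∣ ∷ ∣ suc x - k + y ∣ ∷ zigzagSteps k (suc x) y

length-zigzag : ∀ k x y → length (zigzag k x y) ≡ 1 + 2 * k
length-zigzag zero x y = refl
length-zigzag (suc k) x y = trans (cong (2 +_) (length-zigzag k (suc x) y)) (lemma k)
  where
  lemma : ∀ k → 2 + (1 + 2 * k) ≡ 1 + 2 * suc k
  lemma = solve-∀

∈-zigzag-ascending : ∀ k x y i → i ≤ k → x + i ∈ zigzag k x y
∈-zigzag-ascending zero x y zero _ = here (+-identityʳ x)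
∈-zigzag-ascending (suc k) x y zero _ = here (+-identityʳ x)
∈-zigzag-ascending (suc k) x y (suc i) (s≤s i≤k) =
  there (there (∈-≡ (sym (+-suc x i)) (∈-zigzag-ascending k (suc x) y i i≤k)))

∈-zigzag-descending : ∀ k x y i → i < k → y + i ∈ zigzag k x y
∈-zigzag-descending (suc k) x y i (s≤s i≤k) with m≤n⇒m<n∨m≡n i≤k
... | inj₁ i<k = there (there (∈-zigzag-descending k (suc x) y i i<k))
... | inj₂ refl = there (here (+-comm y k))

-- The entering step depends on `p`, the inner ones do not, and the path continues from the last
-- vertex `x + k`. Hence pieces can be analysed separately.
steps-zigzag : ∀ k p x y xs →
               steps p (zigzag k x y ++ xs) ≡ ∣ x - p ∣ ∷ zigzagSteps k x y ++ steps (x + k) xs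
steps-zigzag zero p x y xs rewrite +-identityʳ x = refl
steps-zigzag (suc k) p x y xs
  rewrite steps-zigzag k (k + y) (suc x) y xs | +-suc x k = refl

-- The ascending side lies below the descending one, so the differences fall from `e + 2k - 1` to
-- `e`. A round keeps `x + k`, hence `e`, and peels off the two largest offsets.
∈-zigzagSteps-inward : ∀ k x e i → i < 2 * k → e + i ∈ zigzagSteps k x (x + k + e)
∈-zigzagSteps-inward (suc k) x e i i< = case m≤n⇒m<n∨m≡n (s≤s⁻¹ i≤) of λ
  { (inj₂ refl) → here (sym (trans (cong ∣_- x ∣ (lemma₁ k x e))
      (trans (∣-∣-comm (x + (e + suc (2 * k))) x) (∣m-m+n∣≡n x _))))
  ; (inj₁ i<) → case m≤n⇒m<n∨m≡n (s≤s⁻¹ i<) of λ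
    { (inj₂ refl) → there (here (sym (trans (cong ∣ suc x -_∣ (lemma₂ k x e)) (∣m-m+n∣≡n (suc x) _))))
    ; (inj₁ i<) → there (there (subst (λ y → e + i ∈ zigzagSteps k (suc x) y) (cong (_+ e) (sym (+-suc x k)))
        (∈-zigzagSteps-inward k (suc x) e i i<))) } }
  where
  i≤ : suc i ≤ 2 + 2 * k
  i≤ = subst (suc i ≤_) (lemma k) i<
    where
    lemma : ∀ k → 2 * suc k ≡ 2 + 2 * k
    lemma = solve-∀
  lemma₁ : ∀ k x e → k + (x + suc k + e) ≡ x + (e + suc (2 * k))
  lemma₁ = solve-∀
  lemma₂ : ∀ k x e → k + (x + suc k + e) ≡ suc x + (e + 2 * k)
  lemma₂ = solve-∀

-- The ascending side lies above, so the differences grow from `e + 1` to `e + 2k`. A round raises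
-- `e` by 2 and peels off the two smallest offsets.
∈-zigzagSteps-outward : ∀ k y e i → i < 2 * k → suc e + i ∈ zigzagSteps k (y + k + e) y
∈-zigzagSteps-outward (suc k) y e zero _ =
  here (sym (trans (cong ∣ k + y -_∣ (lemma k y e)) (∣m-m+n∣≡n (k + y) _)))
  where
  lemma : ∀ k y e → y + suc k + e ≡ k + y + (suc e + 0)
  lemma = solve-∀
∈-zigzagSteps-outward (suc k) y e (suc zero) _ =
  there (here (sym (trans (cong ∣_- k + y ∣ (lemma k y e))
    (trans (∣-∣-comm (k + y + (suc e + 1)) (k + y)) (∣m-m+n∣≡n (k + y) _)))))
  where
  lemma : ∀ k y e → suc (y + suc k + e) ≡ k + y + (suc e + 1)
  lemma = solve-∀
∈-zigzagSteps-outward (suc k) y e (suc (suc i)) i< =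
  there (there (∈-≡ (lemma₁ e i)
    (subst (λ x → suc (2 + e) + i ∈ zigzagSteps k x y) (lemma₂ k y e)
      (∈-zigzagSteps-outward k y (2 + e) i
        (+-cancelˡ-< 2 i (2 * k) (subst (2 + i <_) (lemma₃ k) i<))))))
  where
  lemma₁ : ∀ e i → suc (2 + e) + i ≡ suc e + suc (suc i)
  lemma₁ = solve-∀
  lemma₂ : ∀ k y e → y + k + (2 + e) ≡ suc (y + suc k + e)
  lemma₂ = solve-∀
  lemma₃ : ∀ k → 2 * suc k ≡ 2 + 2 * k
  lemma₃ = solve-∀

zigzagStepInterval : (x y : Affine) →
                     Maybe (∃ λ s → ∀ k → Covers k (zigzagSteps k (⟦ x ⟧ k) (⟦ y ⟧ k)) (s , (0 , 2)))
zigzagStepInterval x y with difference (x ⊕ (0 , 1)) y | difference (y ⊕ (0 , 1)) x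
... | just (e , refl) | _ = just (e , inward)
  where
  inward : ∀ k → Covers k (zigzagSteps k (⟦ x ⟧ k) (⟦ x ⊕ (0 , 1) ⊕ e ⟧ k)) (e , (0 , 2))
  inward k i i< rewrite ⟦⊕⟧ (x ⊕ (0 , 1)) e k | ⟦⊕⟧ x (0 , 1) k | +-identityʳ k =
    ∈-zigzagSteps-inward k (⟦ x ⟧ k) (⟦ e ⟧ k) i (subst (λ m → i < k + m) (sym (+-identityʳ k)) i<)
-- The extra 1 arises because the descending side starts at `y + k - 1`, one below `y + k`.
... | nothing | just (e , refl) = just ((1 , 0) ⊕ e , outward)
  where
  outward : ∀ k → Covers k (zigzagSteps k (⟦ y ⊕ (0 , 1) ⊕ e ⟧ k) (⟦ y ⟧ k)) ((1 , 0) ⊕ e , (0 , 2))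
  outward k i i< rewrite ⟦⊕⟧ (y ⊕ (0 , 1)) e k | ⟦⊕⟧ y (0 , 1) k | +-identityʳ k =
    ∈-zigzagSteps-outward k (⟦ y ⟧ k) (⟦ e ⟧ k) i (subst (λ m → i < k + m) (sym (+-identityʳ k)) i<)
... | nothing | nothing = nothing

-- Symbolic paths

-- Every zigzag has `k` itself as its length, so a path grows with `k` only through its zigzags; for
-- `k = 0`, `zz x y` is the single vertex `x`.
data Piece : Set where
  pt : Affine → Piece
  zz : Affine → Affine → Piece

expand : ℕ → Piece → List ℕ
expand k (pt a) = ⟦ a ⟧ k ∷ []
expand k (zz x y) = zigzag k (⟦ x ⟧ k) (⟦ y ⟧ k)

path : ℕ → List Piece → List ℕ
path k = concatMap (expand k)

vertexIntervals : Piece → List Interval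
vertexIntervals (pt a) = unit a ∷ []
vertexIntervals (zz x y) = (x , (1 , 1)) ∷ (y , (0 , 1)) ∷ []

covers-vertexIntervals : ∀ k p → All (Covers k (expand k p)) (vertexIntervals p)
covers-vertexIntervals k (pt a) = covers-unit a (here refl) ∷ []
covers-vertexIntervals k (zz x y) =
    (λ i i< → ∈-zigzag-ascending k _ _ i (s≤s⁻¹ (subst (λ m → i < 1 + m) (+-identityʳ k) i<)))
  ∷ (λ i i< → ∈-zigzag-descending k _ _ i (subst (i <_) (+-identityʳ k) i<))
  ∷ []

covers-path : ∀ k ps → All (Covers k (path k ps)) (concatMap vertexIntervals ps)
covers-path k [] = []
covers-path k (p ∷ ps) = All.++⁺
  (All.map (λ covers i i< → ∈-++⁺ˡ (covers i i<)) (covers-vertexIntervals k p))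
  (All.map (λ covers i i< → ∈-++⁺ʳ (expand k p) (covers i i<)) (covers-path k ps))

size : List Piece → Affine
size [] = 0 , 0
size (pt _ ∷ ps) = (1 , 0) ⊕ size ps
size (zz _ _ ∷ ps) = (1 , 2) ⊕ size ps

length-path : ∀ k ps → length (path k ps) ≡ ⟦ size ps ⟧ k
length-path k [] = refl
length-path k (pt _ ∷ ps) = cong suc (length-path k ps)
length-path k (zz x y ∷ ps)
  rewrite length-++ (zigzag k (⟦ x ⟧ k) (⟦ y ⟧ k)) {path k ps} | length-path k ps
        | length-zigzag k (⟦ x ⟧ k) (⟦ y ⟧ k) = sym (⟦⊕⟧ (1 , 2) (size ps) k)

-- The intervals are computed from coefficients alone and paired with a proof uniform in `k`, so a
-- tiling can be sought without fixing `k`.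
stepIntervals : ∀ prev ps →
                Maybe (∃ λ is → ∀ k → All (Covers k (steps (⟦ prev ⟧ k) (path k ps))) is)
stepIntervals prev [] = just ([] , λ k → [])
stepIntervals prev (pt a ∷ ps) = do
  s , s≡ ← distance a prev
  is , covers ← stepIntervals a ps
  just (unit s ∷ is , λ k →
      covers-unit s (here (sym (s≡ k)))
    ∷ All.map (λ covers i i< → there (covers i i<)) (covers k))
stepIntervals prev (zz x y ∷ ps) = do
  s , s≡ ← distance x prev
  t , inner ← zigzagStepInterval x y
  is , covers ← stepIntervals (x ⊕ (0 , 1)) ps
  just (unit s ∷ (t , (0 , 2)) ∷ is , λ k →
    subst (λ xs → All (Covers k xs) (unit s ∷ (t , (0 , 2)) ∷ is))
      (sym (steps-zigzag k (⟦ prev ⟧ k) (⟦ x ⟧ k) (⟦ y ⟧ k) (path k ps)))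
      ( covers-unit s (here (sym (s≡ k)))
      ∷ (λ i i< → there (∈-++⁺ˡ (inner k i i<)))
      ∷ All.map (λ covers i i< → there (∈-++⁺ʳ (zigzagSteps k (⟦ x ⟧ k) (⟦ y ⟧ k))
          (cong∈ k (covers i i<)))) (covers k)))
  where
  end : ∀ k → ⟦ x ⊕ (0 , 1) ⟧ k ≡ ⟦ x ⟧ k + k
  end k = trans (⟦⊕⟧ x (0 , 1) k) (cong (⟦ x ⟧ k +_) (+-identityʳ k))
  cong∈ : ∀ k {v} → v ∈ steps (⟦ x ⊕ (0 , 1) ⟧ k) (path k ps) → v ∈ steps (⟦ x ⟧ k + k) (path k ps)
  cong∈ k {v} = subst (λ z → v ∈ steps z (path k ps)) (end k)

path-∷ʳ : ∀ k ps a → path k (ps ++ pt a ∷ []) ≡ path k ps ++ ⟦ a ⟧ k ∷ []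
path-∷ʳ k [] a = refl
path-∷ʳ k (p ∷ ps) a rewrite path-∷ʳ k ps a = sym (++-assoc (expand k p) (path k ps) _)

last-∷ʳ : ∀ (xs : List ℕ) v → last (xs ++ v ∷ []) ≡ just v
last-∷ʳ [] v = refl
last-∷ʳ (x ∷ []) v = refl
last-∷ʳ (x ∷ xs@(_ ∷ _)) v = last-∷ʳ xs v

-- Certificates for symbolic paths

module Candidate (crack second : Affine) (middle : List Piece) where

  -- Working from the crack c = ℓ - 2 avoids truncated subtraction: the ends are c + 3 and c + 2,
  -- and the length 2ℓ - 1 is (c + 3) + c.
  first : Affine
  first = (3 , 0) ⊕ crack

  rest pieces : List Piece
  rest = pt second ∷ middle ++ pt ((2 , 0) ⊕ crack) ∷ []
  pieces = pt first ∷ rest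

  order : Affine
  order = first ⊕ crack

  vertices : List Interval
  vertices = unit crack ∷ concatMap vertexIntervals pieces

  solution : ∀ {d is} → size pieces ≡ order →
             Tiling vertices ((1 , 0) ⊕ order) (0 , 0) →
             Tiling (unit (0 , 0) ∷ is) order (0 , 0) →
             (∀ k → All (Covers k (steps (⟦ first ⟧ k) (path k rest))) is) →
             (∀ k → ∣ ⟦ second ⟧ k - ⟦ first ⟧ k ∣ ≡ d) →
             ∀ k → Solution d (2 + ⟦ crack ⟧ k)
  solution size≡ vertexTiling edgeTiling edgeCovers d≡ k =
      path k pieces
    , proj₁ graceful
    , proj₂ graceful
    , cong just (sym (+-comm (2 + ⟦ crack ⟧ k) 1))
    , trans (cong (λ xs → last (⟦ first ⟧ k ∷ ⟦ second ⟧ k ∷ xs)) (path-∷ʳ k middle ((2 , 0) ⊕ crack)))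
        (last-∷ʳ (⟦ first ⟧ k ∷ ⟦ second ⟧ k ∷ path k middle) _)
    , cong just (d≡ k)
    where
    n≡ : ⟦ order ⟧ k ≡ 2 * (2 + ⟦ crack ⟧ k) ∸ 1
    n≡ = trans (⟦⊕⟧ first crack k) (lemma (⟦ crack ⟧ k))
      where
      lemma : ∀ c → 3 + c + c ≡ suc c + (2 + c + 0)
      lemma = solve-∀
    graceful = cracked-graceful (trans (trans (length-path k pieces) (cong (λ u → ⟦ u ⟧ k) size≡)) n≡)
      (λ v v< → tiling-covers vertexTiling
        ( covers-unit {k} crack (here refl)
        ∷ All.map (λ covers i i< → there (covers i i<)) (covers-path k pieces))
        v (subst (v <_) (cong suc (sym n≡)) v<))
      (λ v v< → tiling-covers edgeTiling
        ( covers-unit {k} (0 , 0) (here refl)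
        ∷ All.map (λ covers i i< → there (covers i i<)) (edgeCovers k))
        v (subst (v <_) (sym n≡) v<))

  -- Proof by evaluation: on closed coefficients every check computes, and `from-just` yields the
  -- claimed type only if all of them succeed.
  certify : ∀ d → Maybe (∀ k → Solution d (2 + ⟦ crack ⟧ k))
  certify d = do
    size≡ ← dec⇒maybe (size pieces ≟ₐ order)
    vertexTiling ← tile (length vertices) vertices ((1 , 0) ⊕ order) (0 , 0)
    is , edgeCovers ← stepIntervals first rest
    -- The added interval is the difference 0 that `cracked-graceful` prepends; the fuel counts it
    -- as well.
    edgeTiling ← tile (suc (length is)) (unit (0 , 0) ∷ is) order (0 , 0)
    e , e≡ ← distance second first
    ≡d ← dec⇒maybe (e ≟ₐ (d , 0))
    just (solution size≡ vertexTiling edgeTiling edgeCovers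
      (λ k → trans (e≡ k) (trans (cong (λ u → ⟦ u ⟧ k) ≡d) (+-identityʳ d))))

open Candidate using (certify)

-- Parametrised families

family5-28 : ∀ k → Solution 5 (28 + 4 * k)
family5-28 = from-just (certify (26 , 4) (24 , 4)
  -- The excursions to `(42 , 6)` here and to `(13 , 2)` near the end visit the left-out vertices.
  -- The jump from `(25 , 4)` to `(55 , 8)` and the excursion to `(0 , 0)` spend 30, 27 and 28, each
  -- plus 4k. The step 1 leads from `(14 , 2)` to `(15 , 2)`; the run from `(32 , 5)` to `(31 , 5)`
  -- uses the small differences 4, 2, 3, 6.
  ( pt (42 , 6) ∷ pt (25 , 4) ∷ pt (55 , 8) ∷ zz (1 , 0) (55 , 7) ∷ pt (54 , 7) ∷
    zz (2 , 1) (54 , 6) ∷ pt (53 , 6) ∷ pt (3 , 2) ∷ pt (52 , 6) ∷ pt (4 , 2) ∷ pt (51 , 6) ∷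
    pt (5 , 2) ∷ pt (50 , 6) ∷ pt (6 , 2) ∷ pt (49 , 6) ∷ pt (7 , 2) ∷ pt (48 , 6) ∷ pt (8 , 2) ∷
    pt (47 , 6) ∷ pt (9 , 2) ∷ pt (46 , 6) ∷ pt (10 , 2) ∷ pt (45 , 6) ∷ pt (11 , 2) ∷ pt (44 , 6) ∷
    pt (12 , 2) ∷ pt (43 , 6) ∷ pt (14 , 2) ∷ zz (15 , 2) (42 , 5) ∷ pt (41 , 5) ∷ pt (16 , 3) ∷
    pt (40 , 5) ∷ pt (17 , 3) ∷ pt (39 , 5) ∷ pt (18 , 3) ∷ pt (38 , 5) ∷ pt (19 , 3) ∷
    pt (35 , 5) ∷ pt (20 , 3) ∷ pt (33 , 5) ∷ pt (21 , 3) ∷ pt (32 , 5) ∷ pt (36 , 5) ∷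
    pt (34 , 5) ∷ pt (37 , 5) ∷ pt (31 , 5) ∷ zz (22 , 3) (31 , 4) ∷ pt (30 , 4) ∷ pt (23 , 4) ∷
    pt (13 , 2) ∷ pt (27 , 4) ∷ pt (0 , 0) ∷ [] ) 5)

family5-26 : ∀ k → Solution 5 (26 + 4 * k)
family5-26 = from-just (certify (24 , 4) (22 , 4)
  ( pt (12 , 2) ∷ pt (23 , 4) ∷ pt (51 , 8) ∷ zz (1 , 0) (51 , 7) ∷ pt (50 , 7) ∷
    zz (2 , 1) (50 , 6) ∷ pt (49 , 6) ∷ pt (3 , 2) ∷ pt (48 , 6) ∷ pt (4 , 2) ∷ pt (47 , 6) ∷
    pt (5 , 2) ∷ pt (46 , 6) ∷ pt (6 , 2) ∷ pt (45 , 6) ∷ pt (7 , 2) ∷ pt (44 , 6) ∷ pt (8 , 2) ∷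
    pt (43 , 6) ∷ pt (9 , 2) ∷ pt (42 , 6) ∷ pt (10 , 2) ∷ pt (41 , 6) ∷ pt (11 , 2) ∷ pt (40 , 6) ∷
    pt (13 , 2) ∷ zz (14 , 2) (39 , 5) ∷ pt (38 , 5) ∷ pt (15 , 3) ∷ pt (37 , 5) ∷ pt (16 , 3) ∷
    pt (36 , 5) ∷ pt (17 , 3) ∷ pt (34 , 5) ∷ pt (18 , 3) ∷ pt (33 , 5) ∷ pt (30 , 5) ∷
    pt (32 , 5) ∷ pt (19 , 3) ∷ pt (31 , 5) ∷ pt (35 , 5) ∷ pt (29 , 5) ∷ zz (20 , 3) (29 , 4) ∷
    pt (28 , 4) ∷ pt (21 , 4) ∷ pt (39 , 6) ∷ pt (25 , 4) ∷ pt (0 , 0) ∷ [] ) 5)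

family6-28 : ∀ k → Solution 6 (28 + 4 * k)
family6-28 = from-just (certify (26 , 4) (23 , 4)
  -- For d = 6 and d = 7 the zigzag is traversed from the centre outward, with growing differences;
  -- for d = 5 it runs inward.
  ( zz (30 , 4) (23 , 3) ∷ pt (22 , 3) ∷ pt (31 , 5) ∷ pt (35 , 5) ∷ pt (33 , 5) ∷ pt (21 , 3) ∷
    pt (32 , 5) ∷ pt (37 , 5) ∷ pt (34 , 5) ∷ pt (20 , 3) ∷ pt (36 , 5) ∷ pt (19 , 3) ∷
    zz (38 , 5) (19 , 2) ∷ pt (18 , 2) ∷ pt (39 , 6) ∷ pt (17 , 2) ∷ pt (40 , 6) ∷ pt (16 , 2) ∷
    pt (15 , 2) ∷ pt (41 , 6) ∷ pt (13 , 2) ∷ pt (42 , 6) ∷ pt (12 , 2) ∷ zz (44 , 6) (12 , 1) ∷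
    pt (11 , 1) ∷ zz (45 , 7) (11 , 0) ∷ pt (10 , 0) ∷ pt (46 , 8) ∷ pt (9 , 0) ∷ pt (47 , 8) ∷
    pt (8 , 0) ∷ pt (48 , 8) ∷ pt (7 , 0) ∷ pt (49 , 8) ∷ pt (6 , 0) ∷ pt (50 , 8) ∷ pt (5 , 0) ∷
    pt (51 , 8) ∷ pt (4 , 0) ∷ pt (52 , 8) ∷ pt (3 , 0) ∷ pt (53 , 8) ∷ pt (2 , 0) ∷ pt (54 , 8) ∷
    pt (1 , 0) ∷ pt (55 , 8) ∷ pt (24 , 4) ∷ pt (14 , 2) ∷ pt (27 , 4) ∷ pt (0 , 0) ∷ pt (25 , 4) ∷
    pt (43 , 6) ∷ [] ) 6)

family6-22 : ∀ k → Solution 6 (22 + 4 * k)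
family6-22 = from-just (certify (20 , 4) (17 , 4)
  ( zz (24 , 4) (17 , 3) ∷ pt (16 , 3) ∷ pt (25 , 5) ∷ pt (30 , 5) ∷ pt (26 , 5) ∷ pt (29 , 5) ∷
    pt (27 , 5) ∷ pt (15 , 3) ∷ pt (28 , 5) ∷ pt (14 , 3) ∷ zz (31 , 5) (14 , 2) ∷ pt (13 , 2) ∷
    pt (12 , 2) ∷ pt (32 , 6) ∷ pt (10 , 2) ∷ pt (33 , 6) ∷ pt (9 , 2) ∷ zz (35 , 6) (9 , 1) ∷
    pt (8 , 1) ∷ zz (36 , 7) (8 , 0) ∷ pt (7 , 0) ∷ pt (37 , 8) ∷ pt (6 , 0) ∷ pt (38 , 8) ∷
    pt (5 , 0) ∷ pt (39 , 8) ∷ pt (4 , 0) ∷ pt (40 , 8) ∷ pt (3 , 0) ∷ pt (41 , 8) ∷ pt (2 , 0) ∷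
    pt (42 , 8) ∷ pt (1 , 0) ∷ pt (43 , 8) ∷ pt (18 , 4) ∷ pt (34 , 6) ∷ pt (19 , 4) ∷ pt (0 , 0) ∷
    pt (21 , 4) ∷ pt (11 , 2) ∷ [] ) 6)

family7-28 : ∀ k → Solution 7 (28 + 4 * k)
family7-28 = from-just (certify (26 , 4) (22 , 4)
  -- For d = 7 the extreme value visited on an excursion is 2ℓ - 1, here `(55 , 8)`, instead of 0.
  ( zz (30 , 4) (22 , 3) ∷ pt (21 , 3) ∷ pt (31 , 5) ∷ pt (37 , 5) ∷ pt (32 , 5) ∷ pt (36 , 5) ∷
    pt (33 , 5) ∷ pt (20 , 3) ∷ pt (34 , 5) ∷ pt (19 , 3) ∷ pt (35 , 5) ∷ pt (18 , 3) ∷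
    zz (38 , 5) (18 , 2) ∷ pt (17 , 2) ∷ pt (39 , 6) ∷ pt (15 , 2) ∷ pt (40 , 6) ∷ pt (14 , 2) ∷
    pt (41 , 6) ∷ pt (13 , 2) ∷ pt (42 , 6) ∷ pt (12 , 2) ∷ pt (11 , 2) ∷ zz (44 , 6) (11 , 1) ∷
    pt (10 , 1) ∷ zz (45 , 7) (10 , 0) ∷ pt (9 , 0) ∷ pt (46 , 8) ∷ pt (8 , 0) ∷ pt (47 , 8) ∷
    pt (7 , 0) ∷ pt (48 , 8) ∷ pt (6 , 0) ∷ pt (49 , 8) ∷ pt (5 , 0) ∷ pt (50 , 8) ∷ pt (4 , 0) ∷
    pt (51 , 8) ∷ pt (3 , 0) ∷ pt (52 , 8) ∷ pt (2 , 0) ∷ pt (53 , 8) ∷ pt (1 , 0) ∷ pt (54 , 8) ∷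
    pt (0 , 0) ∷ pt (23 , 4) ∷ pt (55 , 8) ∷ pt (24 , 4) ∷ pt (43 , 6) ∷ pt (25 , 4) ∷ pt (27 , 4) ∷
    pt (16 , 2) ∷ [] ) 7)

family7-30 : ∀ k → Solution 7 (30 + 4 * k)
family7-30 = from-just (certify (28 , 4) (24 , 4)
  ( zz (32 , 4) (24 , 3) ∷ pt (23 , 3) ∷ pt (33 , 5) ∷ pt (39 , 5) ∷ pt (36 , 5) ∷ pt (38 , 5) ∷
    pt (34 , 5) ∷ pt (22 , 3) ∷ pt (35 , 5) ∷ pt (21 , 3) ∷ pt (37 , 5) ∷ pt (20 , 3) ∷
    zz (40 , 5) (20 , 2) ∷ pt (19 , 2) ∷ pt (41 , 6) ∷ pt (18 , 2) ∷ pt (42 , 6) ∷ pt (17 , 2) ∷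
    pt (16 , 2) ∷ pt (43 , 6) ∷ pt (15 , 2) ∷ pt (44 , 6) ∷ pt (13 , 2) ∷ zz (46 , 6) (13 , 1) ∷
    pt (12 , 1) ∷ zz (47 , 7) (12 , 0) ∷ pt (11 , 0) ∷ pt (48 , 8) ∷ pt (10 , 0) ∷ pt (49 , 8) ∷
    pt (9 , 0) ∷ pt (50 , 8) ∷ pt (8 , 0) ∷ pt (51 , 8) ∷ pt (7 , 0) ∷ pt (52 , 8) ∷ pt (6 , 0) ∷
    pt (53 , 8) ∷ pt (5 , 0) ∷ pt (54 , 8) ∷ pt (4 , 0) ∷ pt (55 , 8) ∷ pt (3 , 0) ∷ pt (56 , 8) ∷
    pt (2 , 0) ∷ pt (57 , 8) ∷ pt (1 , 0) ∷ pt (58 , 8) ∷ pt (0 , 0) ∷ pt (26 , 4) ∷ pt (45 , 6) ∷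
    pt (27 , 4) ∷ pt (59 , 8) ∷ pt (29 , 4) ∷ pt (14 , 2) ∷ pt (25 , 4) ∷ [] ) 7)

-- With slope 0 everywhere, a symbolic path is a single permutation.
single : (ℓ : ℕ) (second : ℕ) (middle : List ℕ) (d : ℕ) → Maybe (∀ k → Solution d (ℓ + 0 * k))
single zero _ _ _ = nothing
single (suc zero) _ _ _ = nothing
single (suc (suc c)) second middle d =
  certify (c , 0) (second , 0) (map (λ v → pt (v , 0)) middle) d

-- Small values of ℓ

solution5-4 : Solution 5 4
solution5-4 = from-just (single 4 0
  ( 6 ∷ 7 ∷ 3 ∷ 1 ∷ [] ) 5) 0

solution5-6 : Solution 5 6
solution5-6 = from-just (single 6 2
  ( 11 ∷ 1 ∷ 3 ∷ 10 ∷ 9 ∷ 5 ∷ 8 ∷ 0 ∷ [] ) 5) 0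

solution5-8 : Solution 5 8
solution5-8 = from-just (single 8 14
  ( 0 ∷ 13 ∷ 1 ∷ 12 ∷ 3 ∷ 7 ∷ 4 ∷ 2 ∷ 10 ∷ 11 ∷ 5 ∷ 15 ∷ [] ) 5) 0

solution5-10 : Solution 5 10
solution5-10 = from-just (single 10 16
  ( 0 ∷ 18 ∷ 1 ∷ 15 ∷ 2 ∷ 17 ∷ 5 ∷ 12 ∷ 4 ∷ 14 ∷ 3 ∷ 6 ∷ 7 ∷ 9 ∷ 13 ∷ 19 ∷ [] ) 5) 0

solution5-12 : Solution 5 12
solution5-12 = from-just (single 12 18
  ( 0 ∷ 22 ∷ 1 ∷ 21 ∷ 2 ∷ 19 ∷ 3 ∷ 17 ∷ 4 ∷ 16 ∷ 5 ∷ 15 ∷ 11 ∷ 20 ∷ 23 ∷ 8 ∷ 9 ∷ 7 ∷ 14 ∷ 6 ∷ [] ) 5) 0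

solution5-14 : Solution 5 14
solution5-14 = from-just (single 14 20
  ( 0 ∷ 26 ∷ 1 ∷ 25 ∷ 2 ∷ 24 ∷ 3 ∷ 22 ∷ 4 ∷ 21 ∷ 5 ∷ 19 ∷ 6 ∷ 18 ∷ 27 ∷ 16 ∷ 8 ∷ 23 ∷ 13 ∷ 7 ∷ 11 ∷
    9 ∷ 10 ∷ 17 ∷ [] ) 5) 0

solution5-16 : Solution 5 16
solution5-16 = from-just (single 16 22
  ( 0 ∷ 30 ∷ 1 ∷ 29 ∷ 2 ∷ 28 ∷ 3 ∷ 27 ∷ 4 ∷ 25 ∷ 5 ∷ 24 ∷ 6 ∷ 23 ∷ 7 ∷ 21 ∷ 8 ∷ 18 ∷ 9 ∷ 15 ∷ 13 ∷
    10 ∷ 11 ∷ 26 ∷ 19 ∷ 31 ∷ 20 ∷ 12 ∷ [] ) 5) 0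

solution5-18 : Solution 5 18
solution5-18 = from-just (single 18 24
  ( 0 ∷ 34 ∷ 1 ∷ 33 ∷ 2 ∷ 32 ∷ 3 ∷ 31 ∷ 4 ∷ 30 ∷ 5 ∷ 28 ∷ 6 ∷ 27 ∷ 7 ∷ 26 ∷ 8 ∷ 25 ∷ 9 ∷ 23 ∷ 10 ∷
    22 ∷ 12 ∷ 13 ∷ 21 ∷ 14 ∷ 17 ∷ 15 ∷ 11 ∷ 20 ∷ 35 ∷ 29 ∷ [] ) 5) 0

solution5-20 : Solution 5 20
solution5-20 = from-just (single 20 26
  ( 0 ∷ 38 ∷ 1 ∷ 37 ∷ 2 ∷ 36 ∷ 3 ∷ 35 ∷ 4 ∷ 34 ∷ 5 ∷ 33 ∷ 6 ∷ 31 ∷ 7 ∷ 30 ∷ 8 ∷ 29 ∷ 9 ∷ 28 ∷ 10 ∷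
    27 ∷ 11 ∷ 25 ∷ 12 ∷ 23 ∷ 13 ∷ 17 ∷ 19 ∷ 16 ∷ 22 ∷ 14 ∷ 15 ∷ 24 ∷ 39 ∷ 32 ∷ [] ) 5) 0

solution5-22 : Solution 5 22
solution5-22 = from-just (single 22 28
  ( 18 ∷ 1 ∷ 43 ∷ 2 ∷ 42 ∷ 3 ∷ 41 ∷ 4 ∷ 40 ∷ 5 ∷ 39 ∷ 6 ∷ 38 ∷ 7 ∷ 37 ∷ 8 ∷ 36 ∷ 9 ∷ 35 ∷ 10 ∷ 34 ∷
    11 ∷ 33 ∷ 12 ∷ 32 ∷ 13 ∷ 31 ∷ 15 ∷ 0 ∷ 14 ∷ 27 ∷ 16 ∷ 25 ∷ 17 ∷ 29 ∷ 30 ∷ 24 ∷ 21 ∷ 19 ∷ 26 ∷ [] ) 5) 0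

solution5-24 : Solution 5 24
solution5-24 = from-just (single 24 20
  ( 0 ∷ 1 ∷ 47 ∷ 2 ∷ 46 ∷ 3 ∷ 45 ∷ 4 ∷ 44 ∷ 5 ∷ 43 ∷ 6 ∷ 42 ∷ 7 ∷ 41 ∷ 8 ∷ 40 ∷ 9 ∷ 39 ∷ 10 ∷ 38 ∷
    11 ∷ 37 ∷ 12 ∷ 36 ∷ 13 ∷ 35 ∷ 14 ∷ 33 ∷ 15 ∷ 32 ∷ 16 ∷ 31 ∷ 17 ∷ 30 ∷ 18 ∷ 29 ∷ 27 ∷ 21 ∷ 28 ∷
    19 ∷ 23 ∷ 26 ∷ 34 ∷ [] ) 5) 0

solution6-6 : Solution 6 6
solution6-6 = from-just (single 6 1
  ( 11 ∷ 2 ∷ 10 ∷ 3 ∷ 0 ∷ 5 ∷ 9 ∷ 8 ∷ [] ) 6) 0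

solution6-8 : Solution 6 8
solution6-8 = from-just (single 8 15
  ( 1 ∷ 14 ∷ 2 ∷ 13 ∷ 3 ∷ 12 ∷ 4 ∷ 0 ∷ 7 ∷ 5 ∷ 10 ∷ 11 ∷ [] ) 6) 0

solution6-10 : Solution 6 10
solution6-10 = from-just (single 10 17
  ( 0 ∷ 18 ∷ 2 ∷ 16 ∷ 1 ∷ 14 ∷ 3 ∷ 15 ∷ 6 ∷ 4 ∷ 5 ∷ 13 ∷ 9 ∷ 19 ∷ 12 ∷ 7 ∷ [] ) 6) 0

solution6-12 : Solution 6 12
solution6-12 = from-just (single 12 19
  ( 0 ∷ 22 ∷ 1 ∷ 21 ∷ 3 ∷ 20 ∷ 4 ∷ 18 ∷ 5 ∷ 17 ∷ 2 ∷ 7 ∷ 11 ∷ 9 ∷ 6 ∷ 16 ∷ 8 ∷ 15 ∷ 14 ∷ 23 ∷ [] ) 6) 0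

solution6-14 : Solution 6 14
solution6-14 = from-just (single 14 21
  ( 0 ∷ 26 ∷ 1 ∷ 25 ∷ 2 ∷ 24 ∷ 4 ∷ 23 ∷ 5 ∷ 22 ∷ 6 ∷ 20 ∷ 7 ∷ 19 ∷ 8 ∷ 16 ∷ 11 ∷ 13 ∷ 9 ∷ 10 ∷ 3 ∷
    18 ∷ 27 ∷ 17 ∷ [] ) 6) 0

solution6-16 : Solution 6 16
solution6-16 = from-just (single 16 23
  ( 0 ∷ 30 ∷ 1 ∷ 29 ∷ 2 ∷ 28 ∷ 3 ∷ 27 ∷ 5 ∷ 26 ∷ 6 ∷ 25 ∷ 7 ∷ 24 ∷ 8 ∷ 22 ∷ 9 ∷ 21 ∷ 11 ∷ 4 ∷ 13 ∷
    18 ∷ 10 ∷ 12 ∷ 15 ∷ 19 ∷ 20 ∷ 31 ∷ [] ) 6) 0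

solution6-18 : Solution 6 18
solution6-18 = from-just (single 18 25
  ( 0 ∷ 34 ∷ 1 ∷ 33 ∷ 2 ∷ 32 ∷ 3 ∷ 31 ∷ 4 ∷ 30 ∷ 6 ∷ 29 ∷ 7 ∷ 28 ∷ 8 ∷ 27 ∷ 9 ∷ 26 ∷ 10 ∷ 24 ∷ 11 ∷
    22 ∷ 12 ∷ 5 ∷ 14 ∷ 17 ∷ 21 ∷ 20 ∷ 35 ∷ 23 ∷ 15 ∷ 13 ∷ [] ) 6) 0

solution6-20 : Solution 6 20
solution6-20 = from-just (single 20 27
  ( 0 ∷ 38 ∷ 1 ∷ 37 ∷ 2 ∷ 36 ∷ 3 ∷ 35 ∷ 4 ∷ 34 ∷ 5 ∷ 33 ∷ 7 ∷ 32 ∷ 8 ∷ 31 ∷ 9 ∷ 30 ∷ 10 ∷ 29 ∷ 11 ∷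
    28 ∷ 12 ∷ 26 ∷ 39 ∷ 24 ∷ 13 ∷ 25 ∷ 16 ∷ 6 ∷ 14 ∷ 19 ∷ 23 ∷ 22 ∷ 15 ∷ 17 ∷ [] ) 6) 0

solution6-24 : Solution 6 24
solution6-24 = from-just (single 24 19
  ( 0 ∷ 46 ∷ 1 ∷ 45 ∷ 2 ∷ 44 ∷ 3 ∷ 43 ∷ 4 ∷ 42 ∷ 5 ∷ 41 ∷ 6 ∷ 40 ∷ 7 ∷ 39 ∷ 8 ∷ 38 ∷ 9 ∷ 37 ∷ 10 ∷
    36 ∷ 11 ∷ 35 ∷ 12 ∷ 34 ∷ 13 ∷ 33 ∷ 15 ∷ 32 ∷ 47 ∷ 31 ∷ 17 ∷ 30 ∷ 18 ∷ 29 ∷ 20 ∷ 28 ∷ 23 ∷ 27 ∷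
    26 ∷ 16 ∷ 14 ∷ 21 ∷ [] ) 6) 0

solution7-6 : Solution 7 6
solution7-6 = from-just (single 6 0
  ( 10 ∷ 1 ∷ 9 ∷ 5 ∷ 3 ∷ 2 ∷ 8 ∷ 11 ∷ [] ) 7) 0

solution7-8 : Solution 7 8
solution7-8 = from-just (single 8 2
  ( 15 ∷ 1 ∷ 13 ∷ 3 ∷ 14 ∷ 5 ∷ 11 ∷ 10 ∷ 12 ∷ 7 ∷ 4 ∷ 0 ∷ [] ) 7) 0

solution7-10 : Solution 7 10
solution7-10 = from-just (single 10 18
  ( 0 ∷ 17 ∷ 1 ∷ 16 ∷ 2 ∷ 15 ∷ 3 ∷ 14 ∷ 4 ∷ 12 ∷ 7 ∷ 5 ∷ 6 ∷ 9 ∷ 13 ∷ 19 ∷ [] ) 7) 0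

solution7-12 : Solution 7 12
solution7-12 = from-just (single 12 20
  ( 0 ∷ 22 ∷ 1 ∷ 19 ∷ 2 ∷ 21 ∷ 5 ∷ 18 ∷ 3 ∷ 17 ∷ 6 ∷ 16 ∷ 4 ∷ 9 ∷ 11 ∷ 7 ∷ 8 ∷ 14 ∷ 23 ∷ 15 ∷ [] ) 7) 0

solution7-14 : Solution 7 14
solution7-14 = from-just (single 14 22
  ( 0 ∷ 26 ∷ 1 ∷ 25 ∷ 2 ∷ 23 ∷ 3 ∷ 21 ∷ 4 ∷ 20 ∷ 5 ∷ 24 ∷ 10 ∷ 19 ∷ 6 ∷ 18 ∷ 13 ∷ 7 ∷ 11 ∷ 8 ∷ 9 ∷
    17 ∷ 27 ∷ 16 ∷ [] ) 7) 0

solution7-16 : Solution 7 16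
solution7-16 = from-just (single 16 24
  ( 0 ∷ 30 ∷ 1 ∷ 29 ∷ 2 ∷ 28 ∷ 3 ∷ 26 ∷ 4 ∷ 25 ∷ 5 ∷ 23 ∷ 6 ∷ 22 ∷ 7 ∷ 21 ∷ 8 ∷ 27 ∷ 18 ∷ 10 ∷ 20 ∷
    31 ∷ 19 ∷ 15 ∷ 9 ∷ 12 ∷ 13 ∷ 11 ∷ [] ) 7) 0

solution7-18 : Solution 7 18
solution7-18 = from-just (single 18 26
  ( 0 ∷ 34 ∷ 1 ∷ 33 ∷ 2 ∷ 32 ∷ 3 ∷ 31 ∷ 4 ∷ 29 ∷ 5 ∷ 28 ∷ 6 ∷ 27 ∷ 7 ∷ 25 ∷ 8 ∷ 24 ∷ 9 ∷ 23 ∷ 11 ∷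
    30 ∷ 35 ∷ 22 ∷ 13 ∷ 15 ∷ 14 ∷ 17 ∷ 21 ∷ 10 ∷ 20 ∷ 12 ∷ [] ) 7) 0

solution7-20 : Solution 7 20
solution7-20 = from-just (single 20 28
  ( 0 ∷ 38 ∷ 1 ∷ 37 ∷ 2 ∷ 36 ∷ 3 ∷ 35 ∷ 4 ∷ 34 ∷ 5 ∷ 32 ∷ 6 ∷ 31 ∷ 7 ∷ 30 ∷ 8 ∷ 29 ∷ 9 ∷ 27 ∷ 10 ∷
    26 ∷ 11 ∷ 25 ∷ 12 ∷ 24 ∷ 13 ∷ 16 ∷ 15 ∷ 19 ∷ 17 ∷ 22 ∷ 14 ∷ 23 ∷ 33 ∷ 39 ∷ [] ) 7) 0

solution7-22 : Solution 7 22
solution7-22 = from-just (single 22 30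
  ( 18 ∷ 1 ∷ 43 ∷ 2 ∷ 42 ∷ 3 ∷ 41 ∷ 4 ∷ 40 ∷ 5 ∷ 39 ∷ 6 ∷ 38 ∷ 7 ∷ 37 ∷ 8 ∷ 36 ∷ 9 ∷ 35 ∷ 10 ∷ 34 ∷
    11 ∷ 33 ∷ 12 ∷ 32 ∷ 13 ∷ 31 ∷ 15 ∷ 0 ∷ 14 ∷ 27 ∷ 16 ∷ 26 ∷ 17 ∷ 21 ∷ 29 ∷ 28 ∷ 25 ∷ 19 ∷ 24 ∷ [] ) 7) 0

solution7-24 : Solution 7 24
solution7-24 = from-just (single 24 32
  ( 0 ∷ 46 ∷ 1 ∷ 45 ∷ 2 ∷ 44 ∷ 3 ∷ 43 ∷ 4 ∷ 42 ∷ 5 ∷ 41 ∷ 6 ∷ 40 ∷ 7 ∷ 38 ∷ 8 ∷ 37 ∷ 9 ∷ 36 ∷ 10 ∷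
    35 ∷ 11 ∷ 34 ∷ 12 ∷ 33 ∷ 13 ∷ 31 ∷ 14 ∷ 30 ∷ 15 ∷ 29 ∷ 16 ∷ 27 ∷ 39 ∷ 47 ∷ 28 ∷ 18 ∷ 23 ∷ 19 ∷
    17 ∷ 26 ∷ 20 ∷ 21 ∷ [] ) 7) 0

solution7-26 : Solution 7 26
solution7-26 = from-just (single 26 34
  ( 0 ∷ 50 ∷ 1 ∷ 49 ∷ 2 ∷ 48 ∷ 3 ∷ 47 ∷ 4 ∷ 46 ∷ 5 ∷ 45 ∷ 6 ∷ 44 ∷ 7 ∷ 43 ∷ 8 ∷ 41 ∷ 9 ∷ 40 ∷ 10 ∷
    39 ∷ 11 ∷ 38 ∷ 12 ∷ 37 ∷ 13 ∷ 36 ∷ 14 ∷ 35 ∷ 15 ∷ 23 ∷ 42 ∷ 51 ∷ 33 ∷ 16 ∷ 32 ∷ 17 ∷ 31 ∷ 18 ∷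
    30 ∷ 19 ∷ 29 ∷ 25 ∷ 28 ∷ 22 ∷ 20 ∷ 21 ∷ [] ) 7) 0

-- Assembling all even ℓ

infixr 5 _▹_
_▹_ : ∀ {d a} → Solution d a → (∀ m → Solution d (2 + a + m * 2)) → ∀ m → Solution d (a + m * 2)
_▹_ {d} {a} s _ zero = subst (Solution d) (sym (+-identityʳ a)) s
_▹_ {d} {a} _ ss (suc m) = subst (Solution d) (lemma a m) (ss m)
  where
  lemma : ∀ a m → 2 + a + m * 2 ≡ a + suc m * 2
  lemma = solve-∀

-- `even` and `odd` refer to the parity of `m`. Lowering `m` by 2 drops the first member of both
-- families and restarts at `4 + a`.
interleave : ∀ {d a} → (∀ k → Solution d (a + 4 * k)) → (∀ k → Solution d (2 + a + 4 * k)) →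
             ∀ m → Solution d (a + m * 2)
interleave even odd zero = even 0
interleave {d} {a} even odd (suc zero) = subst (Solution d) (lemma a) (odd 0)
  where
  lemma : ∀ a → 2 + a + 4 * 0 ≡ a + 1 * 2
  lemma = solve-∀
interleave {d} {a} even odd (suc (suc m)) =
  subst (Solution d) (lemma₁ a m) (interleave
    (λ k → subst (Solution d) (lemma₂ a k) (even (suc k)))
    (λ k → subst (Solution d) (lemma₃ a k) (odd (suc k))) m)
  where
  lemma₁ : ∀ a m → 4 + a + m * 2 ≡ a + suc (suc m) * 2
  lemma₁ = solve-∀
  lemma₂ : ∀ a k → a + 4 * suc k ≡ 4 + a + 4 * k
  lemma₂ = solve-∀
  lemma₃ : ∀ a k → 2 + a + 4 * suc k ≡ 2 + (4 + a) + 4 * k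
  lemma₃ = solve-∀

solutions5 : ∀ m → Solution 5 (4 + m * 2)
solutions5 =
  solution5-4 ▹ solution5-6 ▹ solution5-8 ▹ solution5-10 ▹ solution5-12 ▹ solution5-14 ▹
  solution5-16 ▹ solution5-18 ▹ solution5-20 ▹ solution5-22 ▹ solution5-24 ▹
  interleave family5-26 family5-28

solutions6 : ∀ m → Solution 6 (6 + m * 2)
solutions6 =
  solution6-6 ▹ solution6-8 ▹ solution6-10 ▹ solution6-12 ▹ solution6-14 ▹ solution6-16 ▹
  solution6-18 ▹ solution6-20 ▹ family6-22 0 ▹ solution6-24 ▹ interleave family6-26 family6-28
  where
  -- The family starting at 22 already contains this residue class modulo 4; its first member is
  -- listed separately.
  family6-26 : ∀ k → Solution 6 (26 + 4 * k)
  family6-26 k = subst (Solution 6) (lemma k) (family6-22 (suc k))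
    where
    lemma : ∀ k → 22 + 4 * suc k ≡ 26 + 4 * k
    lemma = solve-∀

solutions7 : ∀ m → Solution 7 (6 + m * 2)
solutions7 =
  solution7-6 ▹ solution7-8 ▹ solution7-10 ▹ solution7-12 ▹ solution7-14 ▹ solution7-16 ▹
  solution7-18 ▹ solution7-20 ▹ solution7-22 ▹ solution7-24 ▹ solution7-26 ▹
  interleave family7-28 family7-30

theorem5p12 : ∀ (d ℓ : ℕ) → d ∈ 5 ∷ 6 ∷ 7 ∷ [] → 2 ∣ ℓ → 2 < ℓ →
    ¬ (ℓ ≡ 4 × d ∈ 6 ∷ 7 ∷ []) →
    ∃[ as ] (CrackedGraceful (2 * ℓ ∸ 1) as
    × IsCrack (2 * ℓ ∸ 1) as (ℓ ∸ 2)
    × head as ≡ just (ℓ + 1)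
    × last as ≡ just ℓ
    × head (differences as) ≡ just d)
-- Splitting on the quotient ℓ / 2: values 0 and 1 contradict `2 < ℓ`, and 2 means ℓ = 4, which is
-- excluded unless d = 5. This is why the progressions start at 4 for d = 5 and at 6 otherwise.
theorem5p12 d _ _ (divides zero refl) () _
theorem5p12 d _ _ (divides (suc zero) refl) (s≤s (s≤s ())) _
theorem5p12 _ _ (here refl) (divides (suc (suc m)) refl) _ _ = solutions5 m
theorem5p12 _ _ (there d∈) (divides (suc (suc zero)) refl) _ ≢4 = ⊥-elim (≢4 (refl , d∈))
theorem5p12 _ _ (there (here refl)) (divides (suc (suc (suc m))) refl) _ _ = solutions6 m
theorem5p12 _ _ (there (there (here refl))) (divides (suc (suc (suc m))) refl) _ _ = solutions7 m
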